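{- No infinite integral domain $(D,+,\cdot,0,1)$ is FA presentable.
   Context: An integral domain $(D,+,\cdot,0,1)$ is a commutative ring with identity such that $x\cdot y=0$ only if $x=0$ or $y=0$. For $\diamond\notin\Sigma$, the convolution $\otimes(w_1,\dots,w_n)$ of a tuple of words over a finite alphabet $\Sigma$ is the word of length $\max_i|w_i|$ over $(\Sigma\cup\{\diamond\})^n$ whose $k$-th symbol is $(\sigma_1,\dots,\sigma_n)$, where $\sigma_i$ is the $k$-th symbol of $w_i$ if $k\le|w_i|$ and $\sigma_i=\diamond$ otherwise. A relation $R\subseteq(\Sigma^\star)^n$ is FA recognisable if $\{\otimes w: w\in R\}$ is a regular language. A structure is FA presentable (has an automatic presentation) if it is isomorphic to a structure whose domain is a regular subset of $\Sigma^\star$ for some finite alphabet $\Sigma$ and whose atomic relations (operations being replaced by their graphs) are FA recognisable. -}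

module Defs where

open import Level using (Level; suc; 0ℓ; _⊔_)
open import Algebra.Bundles using (CommutativeRing)
open import Data.Bool.Base using (Bool; T)
open import Data.Fin.Base using (Fin)
open import Data.List.Base using (List; []; _∷_; foldl; length; applyUpTo)
open import Data.Maybe.Base using (Maybe; just; nothing)
open import Data.Nat.Base as ℕ using (ℕ)
open import Data.Product.Base using (Σ; ∃-syntax; _×_; proj₁)
open import Data.Sum.Base using (_⊎_)
open import Data.Vec.Base as Vec using (Vec; []; _∷_)
open import Data.Vec.Relation.Binary.Pointwise.Inductive using (Pointwise; []; _∷_)
open import Data.Vec.Relation.Unary.All using (All)
open import Function.Bundles using (Inverse; _⇔_)
open import Relation.Binary.Bundles using (Setoid)
open import Relation.Binary.Definitions using (_Respects_)
open import Relation.Binary.PropositionalEquality as ≡ using (_≡_; refl; cong₂; subst)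
import Relation.Binary.Construct.On as On
open import Relation.Nullary.Negation.Core using (¬_)
open import Relation.Unary using (Pred; _∈_; _⊆_)

private variable
  a b c ℓ ℓ₁ ℓ₂ : Level
  A : Set a

Finite : Setoid c ℓ → Set (c ⊔ ℓ)
Finite S = ∃[ n ] Inverse (≡.setoid (Fin n)) S

Infinite : Setoid c ℓ → Set (c ⊔ ℓ)
Infinite S = ¬ Finite S

record IntegralDomain (c ℓ : Level) : Set (suc (c ⊔ ℓ)) where
  field
    commutativeRing : CommutativeRing c ℓ
  open CommutativeRing commutativeRing public
  field
    noZeroDivisors : ∀ x y → x * y ≈ 0# → x ≈ 0# ⊎ y ≈ 0#

record DFA (A : Set a) : Set a where
  field
    states : ℕ
    start  : Fin states
    δ      : Fin states → A → Fin states
    final  : Fin states → Bool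

  Accepts : Pred (List A) 0ℓ
  Accepts w = T (final (foldl δ start w))

Regular : {A : Set a} → Pred (List A) ℓ → Set (a ⊔ ℓ)
Regular {A = A} L = Σ (DFA A) λ M → ∀ w → w ∈ L ⇔ DFA.Accepts M w

-- The padding symbol ⋄ ∉ A is `nothing`; positions are counted from 0.
symbolAt : List A → ℕ → Maybe A
symbolAt []      _         = nothing
symbolAt (x ∷ _) ℕ.zero    = just x
symbolAt (_ ∷ w) (ℕ.suc k) = symbolAt w k

maxLength : ∀ {n} → Vec (List A) n → ℕ
maxLength = Vec.foldr′ (λ w m → length w ℕ.⊔ m) 0

⊗ : ∀ {n} → Vec (List A) n → List (Vec (Maybe A) n)
⊗ ws = applyUpTo (λ k → Vec.map (λ w → symbolAt w k) ws) (maxLength ws)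

FARecognisable : ∀ {A : Set} {n} → Pred (Vec (List A) n) 0ℓ → Set
FARecognisable R = Regular (λ u → ∃[ ws ] (ws ∈ R × u ≡ ⊗ ws))

record Signature : Set₁ where
  field
    Symbol : Set
    arity  : Symbol → ℕ

open Signature

record Structure (S : Signature) (c ℓ : Level) : Set (suc (c ⊔ ℓ)) where
  field
    domain : Setoid c ℓ
  open Setoid domain public using (Carrier; _≈_)
  field
    rel      : ∀ s → Pred (Vec Carrier (arity S s)) ℓ
    rel-resp : ∀ s → rel s Respects Pointwise _≈_

record _≅_ {S : Signature} (𝔄 : Structure S a ℓ₁) (𝔅 : Structure S b ℓ₂)
           : Set (a ⊔ b ⊔ ℓ₁ ⊔ ℓ₂) where
  private
    module 𝔄 = Structure 𝔄
    module 𝔅 = Structure 𝔅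
  field
    bijection : Inverse 𝔄.domain 𝔅.domain
  open Inverse bijection public using (to; from)
  field
    preserves : ∀ s xs → 𝔄.rel s xs ⇔ 𝔅.rel s (Vec.map to xs)

record AutomaticStructure (S : Signature) : Set₁ where
  field
    Alphabet        : Set
    alphabet-finite : Finite (≡.setoid Alphabet)
    Dom             : Pred (List Alphabet) 0ℓ
    Dom-regular     : Regular Dom
    Rel             : ∀ s → Pred (Vec (List Alphabet) (arity S s)) 0ℓ
    Rel⊆Dom         : ∀ s → Rel s ⊆ All Dom
    Rel-recognisable : ∀ s → FARecognisable (Rel s)

  -- Elements are words in `Dom`; two elements are equal when the words are,
  -- irrespective of the membership proofs.
  structure : Structure S 0ℓ 0ℓ
  structure = record
    { domain   = On.setoid (≡.setoid (List Alphabet)) (proj₁ {B = Dom})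
    ; rel      = λ s xs → Rel s (Vec.map proj₁ xs)
    ; rel-resp = λ s xs≈ys → subst (Rel s) (map-proj₁ xs≈ys)
    }
    where
    map-proj₁ : ∀ {n} {xs ys : Vec (Σ (List Alphabet) Dom) n} →
                Pointwise (λ x y → proj₁ x ≡ proj₁ y) xs ys →
                Vec.map proj₁ xs ≡ Vec.map proj₁ ys
    map-proj₁ []       = refl
    map-proj₁ (p ∷ ps) = cong₂ _∷_ p (map-proj₁ ps)

FAPresentable : {S : Signature} → Structure S c ℓ → Set (suc 0ℓ ⊔ c ⊔ ℓ)
FAPresentable {S = S} 𝔄 =
  Σ (AutomaticStructure S) λ 𝔅 → 𝔄 ≅ AutomaticStructure.structure 𝔅

data RingSymbol : Set where
  plus times zero one : RingSymbol

ringSignature : Signature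
ringSignature = record
  { Symbol = RingSymbol
  ; arity  = λ { plus → 3 ; times → 3 ; zero → 1 ; one → 1 }
  }

-- Operations and constants are replaced by their graphs.
ringStructure : CommutativeRing c ℓ → Structure ringSignature c ℓ
ringStructure R = record
  { domain   = setoid
  ; rel      = graph
  ; rel-resp = graph-resp
  }
  where
  open CommutativeRing R

  graph : ∀ s → Pred (Vec Carrier (arity ringSignature s)) _
  graph plus  (x ∷ y ∷ z ∷ []) = x + y ≈ z
  graph times (x ∷ y ∷ z ∷ []) = x * y ≈ z
  graph zero  (x ∷ [])         = 0# ≈ x
  graph one   (x ∷ [])         = 1# ≈ x

  graph-resp : ∀ s → graph s Respects Pointwise _≈_
  graph-resp plus  (p ∷ q ∷ r ∷ []) e = trans (sym (+-cong p q)) (trans e r)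
  graph-resp times (p ∷ q ∷ r ∷ []) e = trans (sym (*-cong p q)) (trans e r)
  graph-resp zero  (p ∷ [])         e = trans e p
  graph-resp one   (p ∷ [])         e = trans e p

{-# OPTIONS --safe #-}
-- For a recognisable relation, the part of one argument lying beyond position m
-- can be replaced by a tail of bounded length as long as all other arguments have
-- length at most m: there the DFA reads ⋄ in every other coordinate, and only the
-- set of states accepting the tail matters ("trimming").  Let Ball n be the set of
-- elements of length at most n.
--   * The value of an operation must equal its own trimming, so sums, differences
--     and products are longer than their arguments by at most a constant.
--   * In an infinite domain some x satisfies no equation a x = b with a ≠ 0 and
--     a, b ∈ Ball m, since each equation excludes only one x; trimming makes x short.
--     With m chosen so that Ball m contains all differences of elements of Ball n,
--     (a , b) ↦ a x + b is injective on Ball n × Ball n, with values in Ball (n + e).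
--   * Trimming an element while recording its old tail embeds Ball (n + e) into
--     Ball n × Words k, for constants e and k.
-- Hence |Ball n|² ≤ |Ball n| · |Words k| for all large n, so the domain is finite.
module Submission where

open import Defs
open import Level using (Level; 0ℓ)
open import Data.Bool.Base as Bool using (Bool)
open import Data.Bool.Properties using (T?)
open import Data.Empty using (⊥)
open import Data.Fin.Base as Fin using (Fin; zero; suc; toℕ; funToFin; finToFun)
open import Data.Fin.Patterns using (1F; 2F)
open import Data.Fin.Properties as Fin
  using (2↔Bool; finToFun-funToFin; pigeonhole; toℕ<n; injective⇒≤; *↔×; any?)
open import Data.List.Base as List
  using (List; []; _∷_; _++_; length; foldl; applyUpTo; take; drop; lookup; deduplicate;
         mapMaybe; cartesianProductWith)
open import Data.List.Properties as List
  using (length-++; length-take; length-drop; take++drop≡id; foldl-++; ++-cancelʳ)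
open import Data.List.Membership.Propositional as ∈ using ()
open import Data.List.Membership.Propositional.Properties
  using (∈-cartesianProductWith⁺; ∈-map⁺; ∈-allFin; ∈-lookup)
open import Data.List.Relation.Unary.All as ListAll using ()
open import Data.List.Relation.Unary.AllPairs using ([]; _∷_)
open import Data.List.Relation.Unary.Any as Any using (here; there; index)
import Data.List.Relation.Unary.Any.Properties as Any
open import Data.List.Relation.Unary.Enumerates.Setoid using (IsEnumeration)
open import Data.List.Relation.Unary.Enumerates.Setoid.Properties using (deduplicate⁺)
open import Data.List.Relation.Unary.Unique.DecSetoid.Properties using (deduplicate-!)
import Data.List.Relation.Unary.Unique.Setoid as Unique
open import Data.Maybe.Base as Maybe using (Maybe; just; nothing; fromMaybe)
import Data.Maybe.Relation.Unary.Any as Maybe using (Any; just)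
open import Data.Nat.Base as ℕ using (ℕ; zero; suc; _≤_; _<_; _∸_; _⊔_; _⊓_; _^_; z≤n; z<s; s<s; s≤s⁻¹)
open import Data.Nat.Properties as ℕ using (≤-trans; ≤-refl; ≤-reflexive; m≤m+n; _≤?_)
open import Data.Product.Base using (∃; ∃-syntax; _×_; _,_; proj₁; proj₂)
open import Data.Product.Function.NonDependent.Setoid using (_×-inverse_)
open import Data.Product.Relation.Binary.Pointwise.NonDependent using (_×ₛ_; Pointwise-≡↔≡)
open import Data.Sum.Base using (inj₁; inj₂)
open import Data.Vec.Base as Vec using (Vec; []; _∷_; replicate; _[_]≔_)
open import Data.Vec.Properties as Vec using (map-[]≔; ∷-injective)
open import Data.Vec.Relation.Unary.All as All using (All; []; _∷_)
import Data.Vec.Relation.Unary.All.Properties as All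
open import Function.Base using (_∘_; id)
open import Function.Bundles using (Inverse; Injection; Equivalence; _⇔_; mk⇔)
import Function.Construct.Composition as Comp
import Function.Construct.Symmetry as Sym
open import Function.Properties.Inverse using (Inverse⇒Injection; ↔⇒↣; ↔-sym)
open import Relation.Binary.Bundles using (Setoid; DecSetoid)
import Relation.Binary.Construct.On as On
open import Relation.Binary.Definitions as Binary using (_Respects_)
open import Relation.Binary.PropositionalEquality as ≡ using (_≡_; refl; cong; cong₂; subst)
open import Relation.Nullary.Decidable
  using (Dec; yes; no; map′; dec⇒maybe; via-injection; _×-dec_; ¬?; decidable-stable)
open import Relation.Nullary.Negation.Core using (¬_; contradiction)
open import Relation.Unary using (Pred; Decidable)

private variable
  a b c ℓ ℓ₁ ℓ₂ : Level
  A B : Set a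
  n : ℕ
  S : Setoid a ℓ₁
  T : Setoid b ℓ₂

-- Shortening words without changing acceptance.

-- Reading an A-word v through f, a DFA only sees the set of states from which
-- v is accepted, so every v can be replaced by one of bounded length.
module Behaviour (M : DFA B) (f : A → B) where
  open DFA M

  -- The number of sets of states, hence at least the number of classes of `_≋_`.
  bound : ℕ
  bound = 2 ^ states

  accepts-from : List A → Fin states → Bool
  accepts-from v q = final (foldl δ q (List.map f v))

  -- A record and not a bare function type, so that `v` and `w` can be inferred from the type of a
  -- proof.
  record _≋_ (v w : List A) : Set where
    constructor same-acceptance
    field accepts-≡ : ∀ q → accepts-from v q ≡ accepts-from w q
  open _≋_

  ≋-refl : ∀ {v} → v ≋ v
  ≋-refl = same-acceptance λ q → refl

  ≋-trans : ∀ {u v w} → u ≋ v → v ≋ w → u ≋ w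
  ≋-trans u≋v v≋w = same-acceptance λ q → ≡.trans (accepts-≡ u≋v q) (accepts-≡ v≋w q)

  ≋-∷ : ∀ x {v w} → v ≋ w → (x ∷ v) ≋ (x ∷ w)
  ≋-∷ x v≋w = same-acceptance λ q → accepts-≡ v≋w (δ q (f x))

  ≋-++ : ∀ u {v w} → v ≋ w → (u ++ v) ≋ (u ++ w)
  ≋-++ []      v≋w = v≋w
  ≋-++ (x ∷ u) v≋w = ≋-∷ x (≋-++ u v≋w)

  behaviour : List A → Fin bound
  behaviour v = funToFin (Inverse.from 2↔Bool ∘ accepts-from v)

  behaviour-≡⇒≋ : ∀ v w → behaviour v ≡ behaviour w → v ≋ w
  behaviour-≡⇒≋ v w eq = same-acceptance λ q → Injection.injective (↔⇒↣ (↔-sym 2↔Bool)) (begin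
    Inverse.from 2↔Bool (accepts-from v q)  ≡⟨ finToFun-funToFin (Inverse.from 2↔Bool ∘ accepts-from v) q ⟨
    finToFun (behaviour v) q                ≡⟨ cong (λ c → finToFun c q) eq ⟩
    finToFun (behaviour w) q                ≡⟨ finToFun-funToFin (Inverse.from 2↔Bool ∘ accepts-from w) q ⟩
    Inverse.from 2↔Bool (accepts-from w q)  ∎)
    where open ≡.≡-Reasoning

  -- Two of the `bound + 1` suffixes starting at positions 0 to `bound` have the same behaviour.
  -- Deleting the segment between their starting points replaces one suffix by the other behind a
  -- fixed prefix.
  cut : ∀ v → bound < length v → ∃[ w ] (length w < length v × w ≋ v)
  cut v long
    with i , j , i<j , eq ← pigeonhole ≤-refl (λ (k : Fin (suc bound)) → behaviour (drop (toℕ k) v))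
    = take (toℕ i) v ++ drop (toℕ j) v , shorter , same
    where
    j≤v : toℕ j ≤ length v
    j≤v = ≤-trans (s≤s⁻¹ (toℕ<n j)) (ℕ.<⇒≤ long)

    shorter : length (take (toℕ i) v ++ drop (toℕ j) v) < length v
    shorter = begin-strict
      length (take (toℕ i) v ++ drop (toℕ j) v)           ≡⟨ length-++ (take (toℕ i) v) ⟩
      length (take (toℕ i) v) ℕ.+ length (drop (toℕ j) v) ≡⟨ cong₂ ℕ._+_ (length-take (toℕ i) v) (length-drop (toℕ j) v) ⟩
      toℕ i ⊓ length v ℕ.+ (length v ∸ toℕ j)             ≤⟨ ℕ.+-monoˡ-≤ _ (ℕ.m⊓n≤m (toℕ i) (length v)) ⟩
      toℕ i ℕ.+ (length v ∸ toℕ j)                        <⟨ ℕ.+-monoˡ-< _ i<j ⟩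
      toℕ j ℕ.+ (length v ∸ toℕ j)                        ≡⟨ ℕ.m+[n∸m]≡n j≤v ⟩
      length v                                            ∎
      where open ℕ.≤-Reasoning

    same : (take (toℕ i) v ++ drop (toℕ j) v) ≋ v
    same = subst ((take (toℕ i) v ++ drop (toℕ j) v) ≋_) (take++drop≡id (toℕ i) v)
      (≋-++ (take (toℕ i) v) (behaviour-≡⇒≋ (drop (toℕ j) v) (drop (toℕ i) v) (≡.sym eq)))

  short-equivalent : ∀ v → ∃[ w ] (length w ≤ bound × w ≋ v)
  short-equivalent []      = [] , z≤n , ≋-refl
  short-equivalent (x ∷ v) with short-equivalent v
  ... | w , w≤ , w≋v with length (x ∷ w) ≤? bound
  ...   | yes xw≤ = x ∷ w , xw≤ , ≋-∷ x w≋v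
  -- The result is shorter than `x ∷ w`, hence no longer than `w`: a single cut suffices.
  ...   | no  xw≰ with w′ , w′< , w′≋xw ← cut (x ∷ w) (ℕ.≰⇒> xw≰)
          = w′ , ≤-trans (s≤s⁻¹ w′<) w≤ , ≋-trans w′≋xw (≋-∷ x w≋v)

  shorten : List A → List A
  shorten = proj₁ ∘ short-equivalent

  shorten-length : ∀ v → length (shorten v) ≤ bound
  shorten-length = proj₁ ∘ proj₂ ∘ short-equivalent

  -- The prefix `u` only determines the state in which the tail is entered, and the two tails agree
  -- from every state.
  shorten-accepts : ∀ u v → DFA.Accepts M (u ++ List.map f v) ≡ DFA.Accepts M (u ++ List.map f (shorten v))
  shorten-accepts u v = cong Bool.T (begin
    final (foldl δ start (u ++ List.map f v))            ≡⟨ cong final (foldl-++ δ start u _) ⟩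
    accepts-from v (foldl δ start u)                     ≡⟨ accepts-≡ (proj₂ (proj₂ (short-equivalent v))) _ ⟨
    accepts-from (shorten v) (foldl δ start u)           ≡⟨ cong final (foldl-++ δ start u _) ⟨
    final (foldl δ start (u ++ List.map f (shorten v)))  ∎)
    where open ≡.≡-Reasoning

  trim : ℕ → List A → List A
  trim m w = take m w ++ shorten (drop m w)

  trim-length : ∀ m w → length (trim m w) ≤ m ℕ.+ bound
  trim-length m w = begin
    length (trim m w)                                     ≡⟨ length-++ (take m w) ⟩
    length (take m w) ℕ.+ length (shorten (drop m w))     ≡⟨ cong (ℕ._+ length (shorten (drop m w))) (length-take m w) ⟩
    m ⊓ length w ℕ.+ length (shorten (drop m w))          ≤⟨ ℕ.+-mono-≤ (ℕ.m⊓n≤m m (length w)) (shorten-length (drop m w)) ⟩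
    m ℕ.+ bound                                           ∎
    where open ℕ.≤-Reasoning

  -- Equal tails have equal shortenings, which cancel on the right and leave equal prefixes.
  trim-injective : ∀ m {v w} → drop m v ≡ drop m w → trim m v ≡ trim m w → v ≡ w
  trim-injective m {v} {w} drop≡ trim≡ = begin
    v                      ≡⟨ take++drop≡id m v ⟨
    take m v ++ drop m v   ≡⟨ cong₂ _++_ take≡ drop≡ ⟩
    take m w ++ drop m w   ≡⟨ take++drop≡id m w ⟩
    w                      ∎
    where
    open ≡.≡-Reasoning
    take≡ : take m v ≡ take m w
    take≡ = ++-cancelʳ (shorten (drop m v)) _ _
      (≡.trans trim≡ (cong (λ t → take m w ++ shorten t) (≡.sym drop≡)))

-- Convolutions

symbolAt-++ˡ : ∀ (u : List A) v {k} → k < length u → symbolAt (u ++ v) k ≡ symbolAt u k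
symbolAt-++ˡ (x ∷ u) v {zero}  _   = refl
symbolAt-++ˡ (x ∷ u) v {suc k} k<u = symbolAt-++ˡ u v (s≤s⁻¹ k<u)

symbolAt-++ʳ : ∀ (u : List A) v k → symbolAt (u ++ v) (length u ℕ.+ k) ≡ symbolAt v k
symbolAt-++ʳ []      v k = refl
symbolAt-++ʳ (x ∷ u) v k = symbolAt-++ʳ u v k

symbolAt-nothing : ∀ (w : List A) {k} → length w ≤ k → symbolAt w k ≡ nothing
symbolAt-nothing []      _           = refl
symbolAt-nothing (x ∷ w) {suc k} w≤k = symbolAt-nothing w (s≤s⁻¹ w≤k)

symbolAt-injective : ∀ (v w : List A) → (∀ k → symbolAt v k ≡ symbolAt w k) → v ≡ w
symbolAt-injective []      []      eq = refl
symbolAt-injective []      (y ∷ w) eq with () ← eq 0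
symbolAt-injective (x ∷ v) []      eq with () ← eq 0
symbolAt-injective (x ∷ v) (y ∷ w) eq with refl ← eq 0 =
  cong (x ∷_) (symbolAt-injective v w (eq ∘ suc))

symbolAt-applyUpTo : ∀ (f : ℕ → A) {m k} → k < m → symbolAt (applyUpTo f m) k ≡ just (f k)
symbolAt-applyUpTo f {suc m} {zero}  _   = refl
symbolAt-applyUpTo f {suc m} {suc k} k<m = symbolAt-applyUpTo (f ∘ suc) (s≤s⁻¹ k<m)

applyUpTo-+ : ∀ (f : ℕ → A) m k → applyUpTo f (m ℕ.+ k) ≡ applyUpTo f m ++ applyUpTo (f ∘ (m ℕ.+_)) k
applyUpTo-+ f zero    k = refl
applyUpTo-+ f (suc m) k = cong (f 0 ∷_) (applyUpTo-+ (f ∘ suc) m k)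

applyUpTo-cong : ∀ {f g : ℕ → A} m → (∀ {k} → k < m → f k ≡ g k) → applyUpTo f m ≡ applyUpTo g m
applyUpTo-cong zero    f≗g = refl
applyUpTo-cong (suc m) f≗g = cong₂ _∷_ (f≗g z<s) (applyUpTo-cong m (f≗g ∘ s<s))

applyUpTo-symbolAt : ∀ (f : Maybe A → B) v → applyUpTo (f ∘ symbolAt v) (length v) ≡ List.map (f ∘ just) v
applyUpTo-symbolAt f []      = refl
applyUpTo-symbolAt f (x ∷ v) = cong (f (just x) ∷_) (applyUpTo-symbolAt f v)

symbolsAt : Vec (List A) n → ℕ → Vec (Maybe A) n
symbolsAt ws k = Vec.map (λ w → symbolAt w k) ws

symbolsAt-nothing : ∀ {ws : Vec (List A) n} {m k} → All (λ w → length w ≤ m) ws → m ≤ k →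
                    symbolsAt ws k ≡ replicate n nothing
symbolsAt-nothing              []         m≤k = refl
symbolsAt-nothing {ws = w ∷ _} (w≤ ∷ ws≤) m≤k =
  cong₂ _∷_ (symbolAt-nothing w (≤-trans w≤ m≤k)) (symbolsAt-nothing ws≤ m≤k)

≤-maxLength : (ws : Vec (List A) n) → All (λ w → length w ≤ maxLength ws) ws
≤-maxLength []       = []
≤-maxLength (w ∷ ws) =
  ℕ.m≤m⊔n _ _ ∷ All.map (λ {v} v≤ → ≤-trans {length v} v≤ (ℕ.m≤n⊔m (length w) _)) (≤-maxLength ws)

maxLength-≤ : ∀ {m} {ws : Vec (List A) n} → All (λ w → length w ≤ m) ws → maxLength ws ≤ m
maxLength-≤ []         = z≤n
maxLength-≤ (w≤ ∷ ws≤) = ℕ.⊔-lub w≤ (maxLength-≤ ws≤)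

maxLength-[]≔ : ∀ {m} {ws : Vec (List A) n} i {w} → All (λ w → length w ≤ m) ws → m ≤ length w →
                maxLength (ws [ i ]≔ w) ≡ length w
maxLength-[]≔ zero    (_  ∷ ws≤) m≤w = ℕ.m≥n⇒m⊔n≡m (≤-trans (maxLength-≤ ws≤) m≤w)
maxLength-[]≔ (suc i) (w≤ ∷ ws≤) m≤w =
  ≡.trans (cong (_ ⊔_) (maxLength-[]≔ i ws≤ m≤w)) (ℕ.m≤n⇒m⊔n≡n (≤-trans w≤ m≤w))

-- Beyond the end of the convolution every coordinate is padding, so the column of `nothing` is the
-- right default.
⊗-symbolsAt : ∀ (ws : Vec (List A) n) k →
              fromMaybe (replicate n nothing) (symbolAt (⊗ ws) k) ≡ symbolsAt ws k
⊗-symbolsAt ws k with k ℕ.<? maxLength ws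
... | yes k<m = cong (fromMaybe _) (symbolAt-applyUpTo (symbolsAt ws) k<m)
... | no  k≮m = ≡.trans
  (cong (fromMaybe _) (symbolAt-nothing (⊗ ws)
    (≤-trans (≤-reflexive (List.length-applyUpTo _ (maxLength ws))) (ℕ.≮⇒≥ k≮m))))
  (≡.sym (symbolsAt-nothing (≤-maxLength ws) (ℕ.≮⇒≥ k≮m)))

symbolsAt-injective : ∀ {vs ws : Vec (List A) n} → (∀ k → symbolsAt vs k ≡ symbolsAt ws k) → vs ≡ ws
symbolsAt-injective {vs = []}     {[]}     eq = refl
symbolsAt-injective {vs = v ∷ vs} {w ∷ ws} eq =
  cong₂ _∷_ (symbolAt-injective v w (proj₁ ∘ ∷-injective ∘ eq))
            (symbolsAt-injective (proj₂ ∘ ∷-injective ∘ eq))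

⊗-injective : ∀ {vs ws : Vec (List A) n} → ⊗ vs ≡ ⊗ ws → vs ≡ ws
⊗-injective {vs = vs} {ws} eq = symbolsAt-injective λ k →
  ≡.trans (≡.sym (⊗-symbolsAt vs k)) (≡.trans (cong (λ u → fromMaybe _ (symbolAt u k)) eq) (⊗-symbolsAt ws k))

-- The symbol read when only argument `i` has letters left.
column : Fin n → A → Vec (Maybe A) n
column i x = replicate _ nothing [ i ]≔ just x

-- All other arguments are exhausted after `length u` positions, so the rest of the convolution is
-- `v` written in columns.
⊗-[]≔-++ : ∀ {ws : Vec (List A) n} i u v → All (λ w → length w ≤ length u) ws →
           ⊗ (ws [ i ]≔ (u ++ v)) ≡ ⊗ (ws [ i ]≔ u) ++ List.map (column i) v
⊗-[]≔-++ {ws = ws} i u v ws≤ = begin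
  applyUpTo f (maxLength (ws [ i ]≔ (u ++ v)))
    ≡⟨ cong (applyUpTo f) max-++ ⟩
  applyUpTo f (length u ℕ.+ length v)
    ≡⟨ applyUpTo-+ f (length u) (length v) ⟩
  applyUpTo f (length u) ++ applyUpTo (f ∘ (length u ℕ.+_)) (length v)
    ≡⟨ cong₂ _++_ (applyUpTo-cong (length u) head-≡) (applyUpTo-cong (length v) λ {k} _ → tail-≡ k) ⟩
  applyUpTo (symbolsAt (ws [ i ]≔ u)) (length u) ++ applyUpTo (pad ∘ symbolAt v) (length v)
    ≡⟨ cong₂ _++_ (cong (applyUpTo _) (≡.sym (maxLength-[]≔ i ws≤ ≤-refl))) (applyUpTo-symbolAt pad v) ⟩
  ⊗ (ws [ i ]≔ u) ++ List.map (column i) v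
    ∎
  where
  open ≡.≡-Reasoning
  f = symbolsAt (ws [ i ]≔ (u ++ v))

  pad : Maybe _ → Vec (Maybe _) _
  pad s = replicate _ nothing [ i ]≔ s

  max-++ : maxLength (ws [ i ]≔ (u ++ v)) ≡ length u ℕ.+ length v
  max-++ = ≡.trans (maxLength-[]≔ i ws≤ (≤-trans (m≤m+n _ _) (≤-reflexive (≡.sym (length-++ u))))) (length-++ u)

  head-≡ : ∀ {k} → k < length u → f k ≡ symbolsAt (ws [ i ]≔ u) k
  head-≡ {k} k<u = ≡.trans (map-[]≔ _ ws i)
    (≡.trans (cong (symbolsAt ws k [ i ]≔_) (symbolAt-++ˡ u v k<u)) (≡.sym (map-[]≔ _ ws i)))

  tail-≡ : ∀ k → f (length u ℕ.+ k) ≡ pad (symbolAt v k)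
  tail-≡ k = ≡.trans (map-[]≔ _ ws i)
    (cong₂ (_[ i ]≔_) (symbolsAt-nothing ws≤ (m≤m+n _ _)) (symbolAt-++ʳ u v k))

-- Trimming one argument of a recognisable relation.

module Recogniser {A : Set} {n} {R : Pred (Vec (List A) n) 0ℓ} (rec : FARecognisable R) where
  open DFA (proj₁ rec) using (Accepts)

  -- The automaton recognises a set of convolutions; injectivity of `⊗` recovers the tuple from an
  -- accepted one.
  ∈⇔Accepts : ∀ ws → R ws ⇔ Accepts (⊗ ws)
  ∈⇔Accepts ws = mk⇔
    (λ r → Equivalence.to (proj₂ rec (⊗ ws)) (ws , r , refl))
    (λ acc → let (ws′ , r , eq) = Equivalence.from (proj₂ rec (⊗ ws)) acc in
             subst R (⊗-injective (≡.sym eq)) r)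

  module _ (i : Fin n) where
    open Behaviour (proj₁ rec) (column i) public using (bound; trim; trim-length; trim-injective)
    open Behaviour (proj₁ rec) (column i) using (shorten; shorten-accepts; shorten-length)

    -- If `w` reaches position `m`, then `take m w` has length exactly `m` and only columns of
    -- argument `i` follow it, so the shortened tail is accepted from the same states.
    trim-⇔ : ∀ {m ws} → All (λ w → length w ≤ m) ws → ∀ w → R (ws [ i ]≔ w) ⇔ R (ws [ i ]≔ trim m w)
    trim-⇔ {m} {ws} ws≤ w with m ≤? length w
    ... | yes m≤w = subst (λ w′ → R (ws [ i ]≔ w′) ⇔ R (ws [ i ]≔ trim m w)) (take++drop≡id m w)
                      (mk⇔ (Equivalence.from (∈⇔Accepts _) ∘ subst id accepts-≡ ∘ Equivalence.to (∈⇔Accepts _))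
                           (Equivalence.from (∈⇔Accepts _) ∘ subst id (≡.sym accepts-≡) ∘ Equivalence.to (∈⇔Accepts _)))
      where
      ws≤take : All (λ w′ → length w′ ≤ length (take m w)) ws
      ws≤take = subst (λ k → All (λ w′ → length w′ ≤ k) ws)
        (≡.sym (≡.trans (length-take m w) (ℕ.m≤n⇒m⊓n≡m m≤w))) ws≤

      accepts-≡ : Accepts (⊗ (ws [ i ]≔ (take m w ++ drop m w))) ≡ Accepts (⊗ (ws [ i ]≔ trim m w))
      accepts-≡ = ≡.trans (cong Accepts (⊗-[]≔-++ i (take m w) _ ws≤take))
        (≡.trans (shorten-accepts (⊗ (ws [ i ]≔ take m w)) (drop m w))
               (cong Accepts (≡.sym (⊗-[]≔-++ i (take m w) _ ws≤take))))
    -- Nothing lies beyond position `m`, and `shorten []` computes to `[]`, so trimming leaves `w`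
    -- unchanged.
    ... | no  m≰w = subst (λ w′ → R (ws [ i ]≔ w) ⇔ R (ws [ i ]≔ w′)) (≡.sym trim≡) (mk⇔ id id)
      where
      drop≡ : drop m w ≡ []
      drop≡ = List.drop-all m w (ℕ.≰⇒≥ m≰w)

      trim≡ : trim m w ≡ w
      trim≡ = begin
        take m w ++ shorten (drop m w)  ≡⟨ cong (λ v → take m w ++ shorten v) drop≡ ⟩
        take m w ++ []                  ≡⟨ cong (take m w ++_) drop≡ ⟨
        take m w ++ drop m w            ≡⟨ take++drop≡id m w ⟩
        w                               ∎
        where open ≡.≡-Reasoning

-- Finite setoids

-- Equality ignores the proofs of membership, so cardinalities count elements only.
Sub : (S : Setoid a ℓ₁) → Pred (Setoid.Carrier S) ℓ → Setoid _ _
Sub S P = On.setoid S (proj₁ {B = P})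

card : Finite S → ℕ
card = proj₁

card-mono : (F : Finite S) (G : Finite T) → Injection S T → card F ≤ card G
card-mono (_ , f) (_ , g) i = injective⇒≤ (Injection.injective
  (Comp.injection (Inverse⇒Injection f) (Comp.injection i (Inverse⇒Injection (Sym.inverse g)))))

_×-finite_ : Finite S → Finite T → Finite (S ×ₛ T)
(m , f) ×-finite (n , g) =
  m ℕ.* n , Comp.inverse *↔× (Comp.inverse (Sym.inverse Pointwise-≡↔≡) (f ×-inverse g))

Fin-finite : ∀ n → Finite (≡.setoid (Fin n))
Fin-finite n = n , record
  { to = id ; from = id ; to-cong = id ; from-cong = id ; inverse = id , id }

finite-any? : ∀ {p} {P : Pred (Setoid.Carrier S) p} → Finite S →
              P Respects (Setoid._≈_ S) → Decidable P → Dec (∃ P)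
finite-any? {S = S} {P = P} (_ , f) resp P? =
  map′ (λ (i , p) → to i , p) (λ (x , p) → from x , resp (S.sym (strictlyInverseˡ x)) p)
       (any? (P? ∘ to))
  where
  open Inverse f
  module S = Setoid S

module _ (S? : DecSetoid a ℓ) where
  open DecSetoid S? using (Carrier; _≈_; _≟_; setoid)
  private module ≈ = DecSetoid S?
  open Unique setoid using (Unique)

  lookup-injective : ∀ {xs} → Unique xs → ∀ i j → lookup xs i ≈ lookup xs j → i ≡ j
  lookup-injective (_ ∷ _)    zero    zero    _ = refl
  lookup-injective (x≉ ∷ _)   zero    (suc j) e = contradiction e (ListAll.lookup x≉ (∈-lookup j))
  lookup-injective (x≉ ∷ _)   (suc i) zero    e = contradiction (≈.sym e) (ListAll.lookup x≉ (∈-lookup i))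
  lookup-injective (_ ∷ uniq) (suc i) (suc j) e = cong suc (lookup-injective uniq i j e)

  bijective⇒finite : ∀ {k} (f : Fin k → Carrier) → (∀ i j → f i ≈ f j → i ≡ j) →
                     (∀ x → ∃[ i ] x ≈ f i) → Finite setoid
  bijective⇒finite f inj surj = _ , record
    { to        = f
    ; from      = proj₁ ∘ surj
    ; to-cong   = λ { refl → ≈.refl }
    ; from-cong = λ {x} {y} x≈y →
        inj _ _ (≈.trans (≈.sym (proj₂ (surj x))) (≈.trans x≈y (proj₂ (surj y))))
    ; inverse   = (λ { {x} refl → ≈.sym (proj₂ (surj x)) })
                , (λ {i} {x} x≈fi → inj _ _ (≈.trans (≈.sym (proj₂ (surj x))) x≈fi))
    }

  -- After removal of repetitions, positions in the list number the elements bijectively.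
  enumeration⇒finite : ∀ {xs} → IsEnumeration setoid xs → Finite setoid
  enumeration⇒finite {xs} enum =
    bijective⇒finite (lookup ys) (lookup-injective (deduplicate-! S? xs))
      (λ x → index (enum′ x) , Any.lookup-index (enum′ x))
    where
    ys    = deduplicate _≟_ xs
    enum′ = deduplicate⁺ S? enum

  -- If no element lay outside an injective family of size `k`, decidable equality would make the
  -- family a bijection. The double negation remains because `Infinite` only refutes finiteness and
  -- supplies no new element.
  infinite⇒large : Infinite setoid → ∀ k → ¬ ¬ Injection (≡.setoid (Fin k)) setoid
  infinite⇒large inf zero    ¬f = ¬f record
    { to = λ () ; cong = λ { {()} } ; injective = λ { {()} } }
  infinite⇒large inf (suc k) ¬f = infinite⇒large inf k λ g →
    let open Injection g using (injective) renaming (to to g₀) in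
    inf (bijective⇒finite g₀ (λ _ _ → injective) λ x →
      decidable-stable (any? (λ i → x ≟ g₀ i)) λ x∉g →
        ¬f (record
          { to        = λ { zero → x ; (suc i) → g₀ i }
          ; cong      = λ { refl → ≈.refl }
          ; injective = λ
            { {zero}  {zero}  _ → refl
            ; {zero}  {suc j} e → contradiction (j , e) x∉g
            ; {suc i} {zero}  e → contradiction (i , ≈.sym e) x∉g
            ; {suc i} {suc j} e → cong suc (injective e)
            }
          }))

  -- Stated for a bare function because it is applied to a choice of witnesses, which may differ on
  -- equal elements. Composing with a map from `Fin` restores congruence.
  infinite⇒¬injection : Infinite setoid → (F : Finite T) (let open Setoid T using () renaming (_≈_ to _≈ᵀ_)) →
                        (f : Carrier → Setoid.Carrier T) → ¬ (∀ {x y} → f x ≈ᵀ f y → x ≈ y)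
  infinite⇒¬injection {T = T} inf F f f-inj = infinite⇒large inf (suc (card F)) λ g →
    ℕ.1+n≰n (card-mono (Fin-finite (suc (card F))) F (record
      { to        = f ∘ Injection.to g
      ; cong      = λ { refl → Setoid.refl T }
      ; injective = Injection.injective g ∘ f-inj
      }))

-- Words of bounded length over a finite alphabet.

module FiniteAlphabet {A : Set} (A-finite : Finite (≡.setoid A)) where
  open Inverse (proj₂ A-finite)

  infix 4 _≟ʷ_
  _≟ʷ_ : Binary.DecidableEquality (List A)
  _≟ʷ_ = List.≡-dec (via-injection (Inverse⇒Injection (Sym.inverse (proj₂ A-finite))) Fin._≟_)

  letters : List A
  letters = List.map to (List.allFin (card A-finite))

  words≤ : ℕ → List (List A)
  words≤ zero    = [] ∷ []
  words≤ (suc k) = [] ∷ cartesianProductWith _∷_ letters (words≤ k)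

  words≤-complete : ∀ k w → length w ≤ k → w ∈.∈ words≤ k
  words≤-complete zero    []      _  = here refl
  words≤-complete (suc k) []      _  = here refl
  words≤-complete (suc k) (x ∷ w) w≤ = there (∈-cartesianProductWith⁺ _∷_
    (subst (∈._∈ letters) (strictlyInverseˡ x) (∈-map⁺ to (∈-allFin (from x))))
    (words≤-complete k w (s≤s⁻¹ w≤)))

  -- The finitely many words of length at most `k` are listed, and those in the image are replaced
  -- by preimages.
  bounded⇒finite : (f : Injection S (≡.setoid (List A))) (let open Injection f renaming (to to f₀)) →
                   ∀ k → (∀ x → length (f₀ x) ≤ k) → (∀ w → Dec (∃[ x ] f₀ x ≡ w)) → Finite S
  bounded⇒finite {S = S} f k f≤k image? = enumeration⇒finite S? {mapMaybe preimage (words≤ k)} enum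
    where
    open Injection f using (injective) renaming (to to f₀)

    S? : DecSetoid _ _
    S? = record { isDecEquivalence = record
      { isEquivalence = Setoid.isEquivalence S ; _≟_ = via-injection f _≟ʷ_ } }

    preimage : List A → Maybe (Setoid.Carrier S)
    preimage w = Maybe.map proj₁ (dec⇒maybe (image? w))

    preimage-complete : ∀ x {w} → f₀ x ≡ w → Maybe.Any (Setoid._≈_ S x) (preimage w)
    preimage-complete x {w} fx≡w with image? w
    ... | yes (y , fy≡w) = Maybe.just (injective (≡.trans fx≡w (≡.sym fy≡w)))
    ... | no  ∄          = contradiction (x , fx≡w) ∄

    enum : IsEnumeration S (mapMaybe preimage (words≤ k))
    enum x = Any.mapMaybe⁺ preimage (words≤ k)
      (Any.map⁺ (Any.map (preimage-complete x) (words≤-complete k (f₀ x) (f≤k x))))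

  Words : ℕ → Setoid 0ℓ 0ℓ
  Words k = Sub (≡.setoid (List A)) (λ w → length w ≤ k)

  words-finite : ∀ k → Finite (Words k)
  words-finite k = bounded⇒finite
    (record { to = proj₁ ; cong = id ; injective = id }) k proj₂
    (λ w → map′ (λ w≤ → (w , w≤) , refl) (λ { ((_ , w≤) , refl) → w≤ }) (length w ≤? k))

-- Automatic presentations

module Presentation {Σ′ : Signature} {𝔄 : Structure Σ′ c ℓ} (pres : FAPresentable 𝔄) where
  open Structure 𝔄
  open AutomaticStructure (proj₁ pres)
  open _≅_ (proj₂ pres)
  open FiniteAlphabet alphabet-finite public

  Word : Set
  Word = List Alphabet

  ⟦⟧-injection : Injection domain (≡.setoid Word)
  ⟦⟧-injection = record
    { to = proj₁ ∘ to ; cong = to-cong ; injective = Injection.injective (Inverse⇒Injection bijection) }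
    where open Inverse bijection using (to-cong)

  open Injection ⟦⟧-injection public
    using () renaming (to to ⟦_⟧; cong to ⟦⟧-cong; injective to ⟦⟧-injective)

  infix 4 _≟_
  _≟_ : Binary.Decidable _≈_
  _≟_ = via-injection ⟦⟧-injection _≟ʷ_

  ∣_∣ : Carrier → ℕ
  ∣ x ∣ = length ⟦ x ⟧

  element : ∀ {w} → Dom w → ∃[ x ] ⟦ x ⟧ ≡ w
  element {w} w∈Dom = from (w , w∈Dom) , Inverse.strictlyInverseˡ bijection (w , w∈Dom)

  Ball : ℕ → Setoid _ _
  Ball n = Sub domain (λ x → ∣ x ∣ ≤ n)

  ball-finite : ∀ n → Finite (Ball n)
  ball-finite n = bounded⇒finite
    (record { to = ⟦_⟧ ∘ proj₁ ; cong = ⟦⟧-cong ; injective = ⟦⟧-injective }) n proj₂ image?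
    where
    -- Membership is decided by running the automaton for `Dom`.
    Dom? : Decidable Dom
    Dom? w = map′ from′ to′ (T? _)
      where open Equivalence (proj₂ Dom-regular w) renaming (to to to′; from to from′)

    image? : ∀ w → Dec (∃[ x ] ⟦ proj₁ x ⟧ ≡ w)
    image? w = map′
      (λ (w∈Dom , w≤n) → let (x , ⟦x⟧≡w) = element w∈Dom in
        (x , subst (λ v → length v ≤ n) (≡.sym ⟦x⟧≡w) w≤n) , ⟦x⟧≡w)
      (λ { ((x , x≤n) , refl) → proj₂ (to x) , x≤n })
      (Dom? w ×-dec (length w ≤? n))

  module Trimming (s : Signature.Symbol Σ′) (i : Fin (Signature.arity Σ′ s)) where
    private module R = Recogniser (Rel-recognisable s)
    open R using () renaming (bound to bound′; trim to trim′)

    bound : ℕ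
    bound = bound′ i

    rel-[]≔ : ∀ xs z → rel s (xs [ i ]≔ z) ⇔ Rel s (Vec.map ⟦_⟧ xs [ i ]≔ ⟦ z ⟧)
    rel-[]≔ xs z = subst (λ ws → rel s (xs [ i ]≔ z) ⇔ Rel s ws)
      (≡.trans (≡.sym (Vec.map-∘ proj₁ to (xs [ i ]≔ z))) (map-[]≔ ⟦_⟧ xs i))
      (preserves s (xs [ i ]≔ z))

    trimWord : ℕ → Word → Word
    trimWord = trim′ i

    -- A relation and not an operation: the trimmed word denotes an element only if it lies in
    -- `Dom`.
    IsTrim : ℕ → Carrier → Carrier → Set
    IsTrim m z z′ = ⟦ z′ ⟧ ≡ trimWord m ⟦ z ⟧

    Bounded : ℕ → ∀ {n} → Vec Carrier n → Set _
    Bounded m = All (λ x → ∣ x ∣ ≤ m)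

    trim-length : ∀ {m z z′} → IsTrim m z z′ → ∣ z′ ∣ ≤ m ℕ.+ bound
    trim-length {m} {z} z↦z′ = subst (λ w → length w ≤ m ℕ.+ bound) (≡.sym z↦z′) (R.trim-length i m ⟦ z ⟧)

    trim-injective : ∀ {m y y′ z z′} → IsTrim m y y′ → IsTrim m z z′ →
                     drop m ⟦ y ⟧ ≡ drop m ⟦ z ⟧ → y′ ≈ z′ → y ≈ z
    trim-injective {m} y↦y′ z↦z′ tail≡ y′≈z′ = ⟦⟧-injective (R.trim-injective i m tail≡
      (≡.trans (≡.sym y↦y′) (≡.trans (⟦⟧-cong y′≈z′) z↦z′)))

    -- One instance of the relation at `z` passes to the trimmed word, and `Rel⊆Dom` then places
    -- that word in `Dom`.
    trim-exists : ∀ {m xs z} → Bounded m xs → rel s (xs [ i ]≔ z) → ∃[ z′ ] IsTrim m z z′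
    trim-exists {m} {xs} {z} xs≤m r = element (subst Dom (Vec.lookup∘updateAt i (Vec.map ⟦_⟧ xs))
      (All.lookup⁺ (Rel⊆Dom s (Equivalence.to (R.trim-⇔ i (All.map⁺ xs≤m) ⟦ z ⟧)
                                              (Equivalence.to (rel-[]≔ xs z) r))) i))

    trim-rel : ∀ {m xs z z′} → Bounded m xs → IsTrim m z z′ → rel s (xs [ i ]≔ z) ⇔ rel s (xs [ i ]≔ z′)
    trim-rel {m} {xs} {z} {z′} xs≤m z↦z′ =
      Comp.equivalence (rel-[]≔ xs z) (Comp.equivalence
        (subst (λ w → Rel s _ ⇔ Rel s (Vec.map ⟦_⟧ xs [ i ]≔ w)) (≡.sym z↦z′) (R.trim-⇔ i (All.map⁺ xs≤m) ⟦ z ⟧))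
        (Sym.equivalence (rel-[]≔ xs z′)))

    -- The trimming satisfies the same relation, so uniqueness identifies it with `z`.
    functional-bound : ∀ {m xs z} → Bounded m xs → rel s (xs [ i ]≔ z) →
                       (∀ {z′} → rel s (xs [ i ]≔ z′) → z ≈ z′) → ∣ z ∣ ≤ m ℕ.+ bound
    functional-bound {m} xs≤m r unique with z′ , z↦z′ ← trim-exists xs≤m r =
      subst (λ w → length w ≤ m ℕ.+ bound)
        (≡.sym (⟦⟧-cong (unique (Equivalence.to (trim-rel xs≤m z↦z′) r)))) (trim-length z↦z′)

-- Bounds on natural numbers.

m*m≤m*n⇒m≤n : ∀ m {n} → m ℕ.* m ≤ m ℕ.* n → m ≤ n
m*m≤m*n⇒m≤n zero    _     = z≤n
m*m≤m*n⇒m≤n (suc m) m²≤mn = ℕ.*-cancelˡ-≤ (suc m) m²≤mn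

fin-bounded : ∀ {k} (f : Fin k → ℕ) → ∃[ m ] (∀ i → f i ≤ m)
fin-bounded {zero}  f = 0 , λ ()
fin-bounded {suc k} f with m , f≤m ← fin-bounded (f ∘ suc) =
  f zero ⊔ m , λ { zero → ℕ.m≤m⊔n _ _ ; (suc i) → ≤-trans (f≤m i) (ℕ.m≤n⊔m (f zero) m) }

-- Integral domains

module _ (D : IntegralDomain c ℓ) where
  open IntegralDomain D hiding (refl)
  open import Algebra.Properties.AbelianGroup +-abelianGroup using (∙-cancelˡ; x∙y⁻¹≈ε⇒x≈y; x≈y⇒x∙y⁻¹≈ε)
  open import Algebra.Properties.Ring ring using (-‿distribʳ-*)
  open import Relation.Binary.Reasoning.Setoid setoid

  +-difference : ∀ x y → y + (x - y) ≈ x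
  +-difference x y = begin
    y + (x - y)    ≈⟨ +-comm y (x - y) ⟩
    x - y + y      ≈⟨ +-assoc x (- y) y ⟩
    x + (- y + y)  ≈⟨ +-congˡ (-‿inverseˡ y) ⟩
    x + 0#         ≈⟨ +-identityʳ x ⟩
    x              ∎

  *-cancelˡ : ∀ {z x y} → z ≉ 0# → z * x ≈ z * y → x ≈ y
  *-cancelˡ {z} {x} {y} z≉0 zx≈zy with noZeroDivisors z (x - y) (begin
    z * (x - y)        ≈⟨ distribˡ z x (- y) ⟩
    z * x + z * (- y)  ≈⟨ +-congˡ (-‿distribʳ-* z y) ⟨
    z * x - z * y      ≈⟨ x≈y⇒x∙y⁻¹≈ε zx≈zy ⟩
    0#                 ∎)
  ... | inj₁ z≈0   = contradiction z≈0 z≉0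
  ... | inj₂ x-y≈0 = x∙y⁻¹≈ε⇒x≈y x y x-y≈0

  -- Turns a collision of `(a , b) ↦ a x + b` into an equation to which the separating property of
  -- `x` applies.
  difference-* : ∀ {a a′ b b′} x → a * x + b ≈ a′ * x + b′ → (a - a′) * x ≈ b′ - b
  difference-* {a} {a′} {b} {b′} x eq = ∙-cancelˡ (a′ * x + b) _ _ (begin
    (a′ * x + b) + (a - a′) * x       ≈⟨ +-congʳ (+-comm _ b) ⟩
    (b + a′ * x) + (a - a′) * x       ≈⟨ +-assoc b _ _ ⟩
    b + (a′ * x + (a - a′) * x)       ≈⟨ +-congˡ (distribʳ x a′ (a - a′)) ⟨
    b + (a′ + (a - a′)) * x           ≈⟨ +-congˡ (*-congʳ (+-difference a a′)) ⟩
    b + a * x                         ≈⟨ +-comm b _ ⟩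
    a * x + b                         ≈⟨ eq ⟩
    a′ * x + b′                       ≈⟨ +-congˡ (+-difference b′ b) ⟨
    a′ * x + (b + (b′ - b))           ≈⟨ +-assoc _ b _ ⟨
    (a′ * x + b) + (b′ - b)           ∎)

  -- Growth of balls in a presented infinite domain.

  module _ (infinite : Infinite setoid) (pres : FAPresentable (ringStructure commutativeRing)) where
    open Presentation pres

    -- Coordinates count from 0. Coordinate `1F` of `plus` is the sum minus the first summand.
    module Sum        = Trimming plus  2F
    module Difference = Trimming plus  1F
    module Product    = Trimming times 2F
    module Factor     = Trimming times 1F

    -- The coordinate that a Trimming replaces is filled with a dummy in each of
    -- the vectors below.
    +-bound : ∀ {m x y} → ∣ x ∣ ≤ m → ∣ y ∣ ≤ m → ∣ x + y ∣ ≤ m ℕ.+ Sum.bound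
    +-bound x≤m y≤m = Sum.functional-bound (x≤m ∷ y≤m ∷ x≤m ∷ []) (reflexive refl) id

    difference-bound : ∀ {m x y} → ∣ x ∣ ≤ m → ∣ y ∣ ≤ m → ∣ x - y ∣ ≤ m ℕ.+ Difference.bound
    difference-bound {x = x} {y} x≤m y≤m = Difference.functional-bound (y≤m ∷ y≤m ∷ x≤m ∷ [])
      (+-difference x y)
      (λ {z} y+z≈x → ∙-cancelˡ y _ z (trans (+-difference x y) (sym y+z≈x)))

    *-bound : ∀ {m x y} → ∣ x ∣ ≤ m → ∣ y ∣ ≤ m → ∣ x * y ∣ ≤ m ℕ.+ Product.bound
    *-bound x≤m y≤m = Product.functional-bound (x≤m ∷ y≤m ∷ x≤m ∷ []) (reflexive refl) id

    -- Every `x` satisfies `0 x = 0`, an instance of the graph of multiplication with short other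
    -- arguments once `0#` has length at most `m`.
    factor-trim : ∀ {m} → ∣ 0# ∣ ≤ m → ∀ x → ∃[ x′ ] Factor.IsTrim m x x′
    factor-trim 0≤m x = Factor.trim-exists (0≤m ∷ 0≤m ∷ 0≤m ∷ []) (zeroˡ x)

    -- A trimming satisfies no new equation with short coefficients, so it inherits the separating
    -- property.
    factor-trim-≈ : ∀ {m x x′ a b} → Factor.IsTrim m x x′ → ∣ a ∣ ≤ m → ∣ b ∣ ≤ m → a * x′ ≈ b → a * x ≈ b
    factor-trim-≈ x↦x′ a≤m b≤m = Equivalence.from (Factor.trim-rel (a≤m ∷ a≤m ∷ b≤m ∷ []) x↦x′)

    -- In the field of fractions: `x` is not a quotient of two elements of length at most `m`.
    Separating : ℕ → Carrier → Set _
    Separating m x = ∀ {a b} → ∣ a ∣ ≤ m → ∣ b ∣ ≤ m → a * x ≈ b → a ≈ 0#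

    D? : DecSetoid _ _
    D? = record { isDecEquivalence = record { isEquivalence = isEquivalence ; _≟_ = _≟_ } }

    module _ (m : ℕ) where
      pairs : Finite (Ball m ×ₛ Ball m)
      pairs = ball-finite m ×-finite ball-finite m

      IsQuotient : Carrier → Setoid.Carrier (Ball m ×ₛ Ball m) → Set _
      IsQuotient x ((a , _) , (b , _)) = a ≉ 0# × a * x ≈ b

      quotient? : ∀ x → Dec (∃ (IsQuotient x))
      quotient? x = finite-any? pairs
        (λ (a≈a′ , b≈b′) (a≉0 , ax≈b) →
          (λ a′≈0 → a≉0 (trans a≈a′ a′≈0)) , trans (*-congʳ (sym a≈a′)) (trans ax≈b b≈b′))
        (λ ((a , _) , (b , _)) → ¬? (a ≟ 0#) ×-dec (a * x ≟ b))

      quotient-unique : ∀ {x y} p q → IsQuotient x p → IsQuotient y q →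
                        Setoid._≈_ (Ball m ×ₛ Ball m) p q → x ≈ y
      quotient-unique _ _ (a≉0 , ax≈b) (_ , a′y≈b′) (a≈a′ , b≈b′) =
        *-cancelˡ a≉0 (trans ax≈b (trans b≈b′ (trans (sym a′y≈b′) (*-congʳ (sym a≈a′)))))

      not-all-quotients : ¬ (∀ x → ∃ (IsQuotient x))
      not-all-quotients quotient = infinite⇒¬injection D? infinite pairs (proj₁ ∘ quotient)
        (λ {x} {y} → quotient-unique (proj₁ (quotient x)) (proj₁ (quotient y))
                                     (proj₂ (quotient x)) (proj₂ (quotient y)))

      -- An `x` that is not a quotient is separating. Being a quotient is decidable by search
      -- through the finitely many pairs, so if no `x` were separating, every `x` would be a
      -- quotient.
      separating-exists : ¬ ¬ ∃ (Separating m)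
      separating-exists none = not-all-quotients λ x →
        decidable-stable (quotient? x) λ ∄ → none (x , λ {a} {b} a≤m b≤m ax≈b →
          decidable-stable (a ≟ 0#) λ a≉0 → ∄ (((a , a≤m) , (b , b≤m)) , a≉0 , ax≈b))

    short-separating-exists : ∀ {m} → ∣ 0# ∣ ≤ m → ¬ ¬ (∃[ x ] (∣ x ∣ ≤ m ℕ.+ Factor.bound × Separating m x))
    short-separating-exists {m} 0≤m none = separating-exists m λ (x , sep) →
      let (x′ , x↦x′) = factor-trim 0≤m x in
      none (x′ , Factor.trim-length x↦x′ ,
            λ a≤m b≤m ax′≈b → sep a≤m b≤m (factor-trim-≈ x↦x′ a≤m b≤m ax′≈b))

    -- The costs, in order, of the coefficient differences, the trimmed separating element, the
    -- product and the sum.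
    growth : ℕ
    growth = Difference.bound ℕ.+ (Factor.bound ℕ.+ (Product.bound ℕ.+ Sum.bound))

    squaring : ∀ {n} → ∣ 0# ∣ ≤ n → ¬ ¬ Injection (Ball n ×ₛ Ball n) (Ball (n ℕ.+ growth))
    squaring {n} 0≤n none = short-separating-exists (≤-trans 0≤n (m≤m+n n d)) λ (x , x≤ , sep) → none record
      { to = λ ((a , a≤n) , (b , b≤n)) → a * x + b ,
          ≤-trans (+-bound (*-bound (≤-trans a≤n n≤n+d+f) x≤) (≤-trans b≤n n≤n+d+f+p)) (≤-reflexive assoc)
      ; cong = λ (a≈a′ , b≈b′) → +-cong (*-congʳ a≈a′) b≈b′
      ; injective = λ { {(a , a≤n) , (b , b≤n)} {(a′ , a′≤n) , (b′ , b′≤n)} eq →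
          -- Both `a - a′` and `b′ - b` have length at most `n + d`, the level at which `x`
          -- separates, so `a - a′` vanishes.
          let a≈a′ = x∙y⁻¹≈ε⇒x≈y a a′ (sep (difference-bound a≤n a′≤n) (difference-bound b′≤n b≤n)
                                            (difference-* x eq))
          in a≈a′ , ∙-cancelˡ (a * x) b b′ (trans eq (+-congʳ (*-congʳ (sym a≈a′)))) }
      }
      where
      d = Difference.bound
      f = Factor.bound
      p = Product.bound

      n≤n+d+f : n ≤ n ℕ.+ d ℕ.+ f
      n≤n+d+f = ≤-trans (m≤m+n n d) (m≤m+n _ f)

      n≤n+d+f+p : n ≤ n ℕ.+ d ℕ.+ f ℕ.+ p
      n≤n+d+f+p = ≤-trans n≤n+d+f (m≤m+n _ p)

      assoc : n ℕ.+ d ℕ.+ f ℕ.+ p ℕ.+ Sum.bound ≡ n ℕ.+ growth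
      assoc = ≡.trans (ℕ.+-assoc (n ℕ.+ d ℕ.+ f) p _) (≡.trans (ℕ.+-assoc (n ℕ.+ d) f _) (ℕ.+-assoc n d _))

    shrinking : ∀ {m} → ∣ 0# ∣ ≤ m → ∀ k → Injection (Ball (m ℕ.+ k)) (Ball (m ℕ.+ Factor.bound) ×ₛ Words k)
    shrinking {m} 0≤m k = record
      { to = λ (x , x≤) → let (x′ , x↦x′) = factor-trim 0≤m x in
          (x′ , Factor.trim-length x↦x′) ,
          (drop m ⟦ x ⟧ , ≤-trans (≤-reflexive (length-drop m ⟦ x ⟧)) (ℕ.m≤n+o⇒m∸n≤o _ m x≤))
      ; cong = λ {(x , _)} {(y , _)} x≈y →
          ⟦⟧-injective (≡.trans (proj₂ (factor-trim 0≤m x))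
            (≡.trans (cong (Factor.trimWord m) (⟦⟧-cong x≈y)) (≡.sym (proj₂ (factor-trim 0≤m y))))) ,
          cong (drop m) (⟦⟧-cong x≈y)
      ; injective = λ {(x , _)} {(y , _)} (x′≈y′ , tail≡) →
          Factor.trim-injective {m} {x} {z = y} (proj₂ (factor-trim 0≤m x)) (proj₂ (factor-trim 0≤m y)) tail≡ x′≈y′
      }

    tail-length : ℕ
    tail-length = Factor.bound ℕ.+ growth

    -- Squaring is used at radius `r`, but trimming at position `m`, so that trimmed elements land
    -- in the ball of radius `r` again and one factor of its cardinality cancels. The recorded tails
    -- then have length at most `tail-length`, whatever `m` is.
    ball-card-bounded : ∀ {m} → ∣ 0# ∣ ≤ m → ¬ ¬ card (ball-finite (m ℕ.+ Factor.bound)) ≤ card (words-finite tail-length)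
    ball-card-bounded {m} 0≤m ≰ = squaring (≤-trans 0≤m (m≤m+n m _)) λ sq → ≰ (bound sq)
      where
      r = m ℕ.+ Factor.bound
      F = ball-finite r
      bound : Injection (Ball r ×ₛ Ball r) (Ball (r ℕ.+ growth)) → card F ≤ card (words-finite tail-length)
      bound sq = m*m≤m*n⇒m≤n _ (card-mono (F ×-finite F) (F ×-finite words-finite tail-length)
        (Comp.injection sq (subst (λ k → Injection (Ball k) (Ball r ×ₛ Words tail-length))
          (≡.sym (ℕ.+-assoc m _ growth))
          (shrinking 0≤m tail-length))))

    -- `K` is independent of the radius, while any `K + 1` distinct elements lie in a common ball.
    -- The goal `⊥` allows the double negations to be opened.
    infinite⇒¬presentable : ⊥
    infinite⇒¬presentable = infinite⇒large D? infinite (suc K) λ f →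
      let (l , f≤l) = fin-bounded (∣_∣ ∘ Injection.to f)
          -- The ball must also contain `0#`, on which the trimming of factors relies.
          m = ∣ 0# ∣ ⊔ l
      in ball-card-bounded {m} (ℕ.m≤m⊔n _ l) λ card≤K →
        ℕ.1+n≰n (≤-trans (card-mono (Fin-finite (suc K)) (ball-finite (m ℕ.+ Factor.bound)) (record
          { to        = λ i → Injection.to f i , ≤-trans (f≤l i) (≤-trans (ℕ.m≤n⊔m ∣ 0# ∣ l) (m≤m+n m _))
          ; cong      = Injection.cong f
          ; injective = Injection.injective f
          })) card≤K)
      where K = card (words-finite tail-length)

theorem3p10 : ∀ {c ℓ : Level} (D : IntegralDomain c ℓ) → Infinite (IntegralDomain.setoid D) → ¬ FAPresentable (ringStructure (IntegralDomain.commutativeRing D))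
theorem3p10 = infinite⇒¬presentable
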